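{- For every finite graph $G$ and every pair of positive integers $g,k$, there exist a finite graph $G'$ with girth at least $g$ and a surjective homomorphism $h:V(G')\to V(G)$ such that for every proper $k$-colouring $c'$ of $G'$ there is a proper $k$-colouring $c$ of $G$ with $c(v)\in c'(h^{ -1}(v))$ for all $v\in V(G)$. In particular $\chi(G')=\chi(G)$.
   Context: A homomorphism from $G'$ to $G$ is a map $h:V(G')\to V(G)$ such that $uv\in E(G')$ implies $h(u)h(v)\in E(G)$. A proper $k$-colouring is a map to $\{1,\dots,k\}$ giving adjacent vertices different colours. For a set $A$ of vertices, $c'(A)$ denotes the set of colours used on $A$. The girth of a graph is the length of its shortest cycle (infinite if acyclic). -}

module Defs where

open import Level using (0ℓ)
open import Data.Nat.Base using (ℕ; zero; suc; _≤_; _<_; s≤s)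
open import Data.Nat.Properties using (_≤?_; ≮⇒≥; m≤n⇒m<n∨m≡n; n<1+n)
import Data.Nat.Properties as ℕ
open import Data.Fin.Base using (Fin; toℕ; finToFun; funToFin)
open import Data.Fin.Properties using (_≟_; any?; all?; finToFun-funToFin; injective⇒≤)
open import Data.Product.Base using (∃; _×_; _,_; proj₁; proj₂)
open import Data.Sum.Base using (_⊎_; inj₁; inj₂)
open import Function.Base using (id; _∘_)
open import Function.Definitions using (Injective)
open import Relation.Binary.Core using (Rel)
open import Relation.Binary.Definitions using (Symmetric; Irreflexive; Decidable)
open import Relation.Binary.Morphism.Definitions using (Homomorphic₂)
open import Relation.Binary.PropositionalEquality using (_≡_; _≢_; _≗_; refl; sym; trans; subst₂)
open import Relation.Nullary using (¬_; Dec; yes; no; ¬?; contradiction)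
open import Relation.Nullary.Construct.Add.Supremum using (_⁺; ⊤⁺; [_])
open import Relation.Nullary.Decidable using (map′; _×-dec_; _→-dec_)
open import Relation.Unary using (Pred; _∈_)
import Relation.Unary as U

record Graph : Set₁ where
  field
    order  : ℕ
    Adj    : Rel (Fin order) 0ℓ
    adj?   : Decidable Adj
    symm   : Symmetric Adj
    irrefl : Irreflexive _≡_ Adj

open Graph public

V : Graph → Set
V G = Fin (order G)

IsHomomorphism : (G′ G : Graph) → (V G′ → V G) → Set
IsHomomorphism G′ G = Homomorphic₂ (V G′) (V G) (Adj G′) (Adj G)

IsProperColouring : (G : Graph) (k : ℕ) → (V G → Fin k) → Set
IsProperColouring G k c = ∀ {u v} → Adj G u v → c u ≢ c v

Image : {A B : Set} → (A → B) → Pred A 0ℓ → Pred B 0ℓ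
Image f S y = ∃ λ x → x ∈ S × f x ≡ y

Colourable : Graph → ℕ → Set
Colourable G k = ∃ (IsProperColouring G k)

IsLeast : Pred ℕ 0ℓ → Pred ℕ 0ℓ
IsLeast P n = P n × (∀ m → P m → n ≤ m)

-- The closed walk x₀ x₁ … x₍ℓ₋₁₎ x₀; `close` is the edge from the last vertex back
-- to x₀.
record IsCycle (G : Graph) (ℓ : ℕ) (x : Fin ℓ → V G) : Set where
  field
    long     : 3 ≤ ℓ
    distinct : Injective _≡_ _≡_ x
    step     : ∀ i j → toℕ j ≡ suc (toℕ i) → Adj G (x i) (x j)
    close    : ∀ i j → suc (toℕ i) ≡ ℓ → toℕ j ≡ 0 → Adj G (x i) (x j)

HasCycle : Graph → ℕ → Set
HasCycle G ℓ = ∃ (IsCycle G ℓ)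

-- ⊤⁺ is the infinite girth of an acyclic graph.
IsGirth : Graph → ℕ ⁺ → Set
IsGirth G [ ℓ ] = IsLeast (HasCycle G) ℓ
IsGirth G ⊤⁺    = ∀ ℓ → ¬ HasCycle G ℓ

private
  least : {P : Pred ℕ 0ℓ} → U.Decidable P → ∀ N →
          ∃ (IsLeast P) ⊎ (∀ m → m < N → ¬ P m)
  least P? zero = inj₂ λ _ ()
  least {P} P? (suc N) with least P? N
  ... | inj₁ found = inj₁ found
  ... | inj₂ none with P? N
  ...   | yes p = inj₁ (N , p , λ m pm → ≮⇒≥ λ m<N → none m m<N pm)
  ...   | no ¬p = inj₂ none′
    where
    none′ : ∀ m → m < suc N → ¬ P m
    none′ m (s≤s m≤N) with m≤n⇒m<n∨m≡n m≤N
    ... | inj₁ m<N  = none m m<N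
    ... | inj₂ refl = ¬p

  anyFun? : ∀ {m n} {P : Pred (Fin m → Fin n) 0ℓ} →
            (∀ {f g} → f ≗ g → P f → P g) → U.Decidable P → Dec (∃ P)
  anyFun? resp P? = map′
    (λ (i , p) → finToFun i , p)
    (λ (f , p) → funToFin f , resp (sym ∘ finToFun-funToFin f) p)
    (any? (P? ∘ finToFun))

  properColouring? : ∀ G k → U.Decidable (IsProperColouring G k)
  properColouring? G k c = map′ (λ p {u} {v} → p u v) (λ p u v → p)
    (all? λ u → all? λ v → adj? G u v →-dec ¬? (c u ≟ c v))

  colourable? : ∀ G → U.Decidable (Colourable G)
  colourable? G k = anyFun?
    (λ f≗g p {u} {v} e eq → p e (trans (f≗g u) (trans eq (sym (f≗g v)))))
    (properColouring? G k)

  colourable-order : ∀ G → Colourable G (order G)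
  colourable-order G = id , λ e eq → irrefl G eq e

  cycle-resp : ∀ {G ℓ} {x y : Fin ℓ → V G} → x ≗ y → IsCycle G ℓ x → IsCycle G ℓ y
  cycle-resp {G} x≗y c = record
    { long     = long
    ; distinct = λ {i} {j} eq → distinct (trans (x≗y i) (trans eq (sym (x≗y j))))
    ; step     = λ i j p → subst₂ (Adj G) (x≗y i) (x≗y j) (step i j p)
    ; close    = λ i j p q → subst₂ (Adj G) (x≗y i) (x≗y j) (close i j p q)
    }
    where open IsCycle c

  cycle? : ∀ G ℓ → U.Decidable (IsCycle G ℓ)
  cycle? G ℓ x = map′
    (λ (l , d , s , c) → record
      { long = l ; distinct = λ {i} {j} → d i j ; step = s ; close = c })
    (λ c → let open IsCycle c in long , (λ i j → distinct) , step , close)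
    ((3 ≤? ℓ)
      ×-dec (all? λ i → all? λ j → (x i ≟ x j) →-dec (i ≟ j))
      ×-dec (all? λ i → all? λ j → (toℕ j ℕ.≟ suc (toℕ i)) →-dec adj? G (x i) (x j))
      ×-dec (all? λ i → all? λ j → (suc (toℕ i) ℕ.≟ ℓ) →-dec ((toℕ j ℕ.≟ 0) →-dec adj? G (x i) (x j))))

  hasCycle? : ∀ G → U.Decidable (HasCycle G)
  hasCycle? G ℓ = anyFun? cycle-resp (cycle? G ℓ)

-- Abstract so that χ and girth never unfold to the exhaustive search; they are
-- used only through χ-isLeast and girth-isGirth.
abstract
  chromaticNumber : ∀ G → ∃ (IsLeast (Colourable G))
  chromaticNumber G with least (colourable? G) (suc (order G))
  ... | inj₁ found = found
  ... | inj₂ none  = contradiction (colourable-order G) (none (order G) (n<1+n _))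

  girthExists : ∀ G → ∃ (IsGirth G)
  girthExists G with least (hasCycle? G) (suc (order G))
  ... | inj₁ (ℓ , p) = [ ℓ ] , p
  ... | inj₂ none    = ⊤⁺ , λ ℓ (x , c) →
          none ℓ (s≤s (injective⇒≤ (IsCycle.distinct c))) (x , c)

χ : Graph → ℕ
χ G = proj₁ (chromaticNumber G)

χ-isLeast : ∀ G → IsLeast (Colourable G) (χ G)
χ-isLeast G = proj₂ (chromaticNumber G)

girth : Graph → ℕ ⁺
girth G = proj₁ (girthExists G)

girth-isGirth : ∀ G → IsGirth G (girth G)
girth-isGirth G = proj₂ (girthExists G)

open import Relation.Binary.Construct.Add.Supremum.NonStrict _≤_ public using (_≤⁺_)

{-# OPTIONS --safe #-}
module Submission where

-- The amalgamation method of Nešetřil and Rödl, for hypergraphs T whose edges are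
-- R-indexed tuples.  By induction on g, there is a hypergraph over T of girth ≥ g in
-- which every k-colouring of the vertices contains, over each edge of T, an edge
-- coloured like that edge under one common k-colouring of T.  For the step to g + 1,
-- start with the disjoint union of the edges of T.  For each vertex v of T in turn,
-- take a hypergraph of girth ≥ g in which every k-colouring has a monochromatic edge
-- (by induction, applied to a hypergraph with this property but no girth condition),
-- and put on each of its edges a copy of the current hypergraph, glued along the
-- vertices over v.  Some copy is then monochromatic over v, so in the end some copy
-- of the initial disjoint union is monochromatic over every v.  A short cycle of the
-- glued hypergraph that is not in one copy projects to a strictly shorter cycle
-- below, because crossing a copy takes at least two edges.  The theorem is the case
-- in which T is G, with max(k, χ(G)) colours.

open import Defs
open import Data.Empty using (⊥)
open import Data.Fin.Base using (Fin; punchOut; zero; suc; toℕ; fromℕ<; finToFun; funToFin; inject≤)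
open import Data.Fin.Properties using (0↔⊥; punchOut-injective; +↔⊎; *↔×; any?; toℕ-fromℕ<; finToFun-funToFin; inject≤-injective)
import Data.Fin.Properties as Fin
open import Data.List.Base using (List; []; _∷_; allFin; cartesianProduct; filter; length; lookup; map)
open import Data.List.Membership.Propositional using () renaming (_∈_ to _∈ˡ_; _∉_ to _∉ˡ_)
open import Data.List.Membership.Propositional.Properties using (∈-allFin; ∈-cartesianProduct⁺; ∈-filter⁺; ∈-filter⁻; ∈-lookup; ∈-map⁺)
open import Data.List.Relation.Unary.Any using (here; there; index)
open import Data.List.Relation.Unary.Any.Properties using (lookup-index)
open import Data.Nat.Base using (ℕ; zero; suc; _+_; _^_; _⊔_; _≤_; _<_; z≤n; s≤s)
open import Data.Nat.Properties using (≤-refl; ≤-trans; ≤-reflexive; ≤-antisym; m≤n⇒m≤1+n; m≤m+n; m≤n+m; m≤m⊔n; m≤n⊔m; +-mono-≤; +-monoˡ-≤; +-suc; +-comm; ≮⇒≥; 1+n≢0; 1+n≢n; m≢1+n+m; <-irrefl; <⇒≢; module ≤-Reasoning)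
open import Data.Product.Base using (Σ-syntax; ∃; ∃₂; _×_; _,_; proj₁; proj₂)
open import Data.Product.Function.NonDependent.Propositional using (_×-↔_)
open import Data.Sum.Base using (_⊎_; inj₁; inj₂)
open import Data.Sum.Function.Propositional using (_⊎-↔_)
open import Data.Sum.Properties using (inj₁-injective)
open import Function.Base using (id; _∘_)
open import Function.Bundles using (_↔_; Injection; Inverse)
open import Function.Construct.Composition using (_↔-∘_)
open import Function.Construct.Identity using (↔-id)
open import Function.Construct.Symmetry using (↔-sym)
open import Function.Definitions using (Injective; Surjective)
open import Function.Properties.Inverse using (↔⇒↣)
open import Relation.Binary.Definitions using (DecidableEquality)
open import Relation.Binary.PropositionalEquality using (_≡_; _≢_; refl; sym; trans; cong; subst; subst₂)
open import Relation.Nullary using (¬_; Dec; yes; no; contradiction)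
open import Relation.Nullary.Construct.Add.Supremum using ([_]; ⊤⁺)
open import Relation.Nullary.Decidable using (decidable-stable; map′; via-injection; _×-dec_; ¬?)
open import Relation.Unary using (_∈_; _⊢_; ｛_｝)

-- Finite types and decidable search over them.

private variable
  A B R : Set

Finite : Set → Set
Finite A = ∃ λ n → A ↔ Fin n

finite-Fin : ∀ n → Finite (Fin n)
finite-Fin n = n , ↔-id _

finite-⊎ : Finite A → Finite B → Finite (A ⊎ B)
finite-⊎ (m , f) (n , g) = m + n , ↔-sym +↔⊎ ↔-∘ (f ⊎-↔ g)

finite-× : Finite A → Finite B → Finite (A × B)
finite-× (_ , f) (_ , g) = _ , ↔-sym *↔× ↔-∘ (f ×-↔ g)

≡-dec : Finite A → DecidableEquality A
≡-dec (_ , f) = via-injection (↔⇒↣ f) Fin._≟_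

elements : Finite A → List A
elements (n , f) = map (Inverse.from f) (allFin n)

∈-elements : (fin : Finite A) (x : A) → x ∈ˡ elements fin
∈-elements (n , f) x =
  subst (_∈ˡ elements (n , f)) (Inverse.strictlyInverseʳ f x) (∈-map⁺ _ (∈-allFin (Inverse.to f x)))

any-finite? : Finite A → {P : A → Set} → (∀ x → Dec (P x)) → Dec (∃ P)
any-finite? (n , f) {P} P? = map′
  (λ (i , p) → Inverse.from f i , p)
  (λ (x , p) → Inverse.to f x , subst P (sym (Inverse.strictlyInverseʳ f x)) p)
  (any? λ i → P? (Inverse.from f i))

-- Hypergraphs, walks and girth.

record Hypergraph (R : Set) : Set₁ where
  field
    Vertex        : Set
    Edge          : Set
    at            : Edge → R → Vertex
    vertex-finite : Finite Vertex
    edge-finite   : Finite Edge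

  _∈ₑ_ : Vertex → Edge → Set
  x ∈ₑ e = ∃ λ i → at e i ≡ x

  _≟ᵛ_ : DecidableEquality Vertex
  _≟ᵛ_ = ≡-dec vertex-finite

  _≟ᵉ_ : DecidableEquality Edge
  _≟ᵉ_ = ≡-dec edge-finite

  EdgesInjective : Set
  EdgesInjective = ∀ e → Injective _≡_ _≡_ (at e)

  -- Walk x e f y n: x = x₀, e = e₁, x₁, …, eₙ = f, xₙ = y without backtracking.
  data Walk : Vertex → Edge → Edge → Vertex → ℕ → Set where
    single : ∀ {x y e} → x ∈ₑ e → y ∈ₑ e → x ≢ y → Walk x e e y 1
    cons   : ∀ {x y z e f f′ n} → x ∈ₑ e → y ∈ₑ e → x ≢ y → e ≢ f →
             Walk y f f′ z n → Walk x e f′ z (suc n)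

  snoc : ∀ {x y z e f f′ n} → Walk x e f y n → f ≢ f′ →
         y ∈ₑ f′ → z ∈ₑ f′ → y ≢ z → Walk x e f′ z (suc n)
  snoc (single x∈ y∈ x≢y) f≢ y∈′ z∈ y≢z = cons x∈ y∈ x≢y f≢ (single y∈′ z∈ y≢z)
  snoc (cons x∈ y∈ x≢y e≢ w) f≢ y∈′ z∈ y≢z = cons x∈ y∈ x≢y e≢ (snoc w f≢ y∈′ z∈ y≢z)

  walk-nonempty : ∀ {x e f y n} → Walk x e f y n → 1 ≤ n
  walk-nonempty (single _ _ _)     = ≤-refl
  walk-nonempty (cons _ _ _ _ _) = s≤s z≤n

  -- A closed walk may have equal first and last edges, but it still contains a
  -- cycle of at most its length.
  GirthAtLeast : ℕ → Set
  GirthAtLeast g = ∀ {x e f n} → n < g → ¬ Walk x e f x n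

  -- Since `e ≢ e₁`, a step from `y` to `x` inside `e` can be put before the walk, which closes it
  -- at length `suc n`; if `x` and `y` coincide, it is closed already.
  girth⇒no-edge-closed : ∀ {g e x y e₁ e₂ n} → GirthAtLeast g → suc n < g →
    x ∈ₑ e → y ∈ₑ e → e ≢ e₁ → ¬ Walk x e₁ e₂ y n
  girth⇒no-edge-closed {x = x} {y} girth n<g x∈ y∈ e≢ w with y ≟ᵛ x
  ... | yes refl = girth (≤-trans (s≤s (m≤n⇒m≤1+n ≤-refl)) n<g) w
  ... | no y≢x   = girth n<g (cons y∈ x∈ y≢x e≢ w)

open Hypergraph

-- Covers and their Ramsey property.

Monochromatic : Hypergraph R → ℕ → Set
Monochromatic H k = ∀ (c : Vertex H → Fin k) → ∃ λ e → ∀ i j → c (at H e i) ≡ c (at H e j)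

record Cover (T : Hypergraph R) : Set₁ where
  field
    total : Hypergraph R
    πᵛ    : Vertex total → Vertex T
    πᵉ    : Edge total → Edge T
    π-at  : ∀ f i → πᵛ (at total f i) ≡ at T (πᵉ f) i

  -- The vertex clause takes care of vertices of `T` on no edge; it later makes the homomorphism
  -- surjective and supplies c(v) ∈ c′(h⁻¹(v)).
  Realises : ∀ {k} → (Vertex total → Fin k) → (Vertex T → Fin k) → Set
  Realises c′ c =
    (∀ e → ∃ λ f → πᵉ f ≡ e × (∀ i → c′ (at total f i) ≡ c (at T e i)))
    × (∀ v → ∃ λ p → πᵛ p ≡ v × c′ p ≡ c v)

  -- `L` lists the classes already treated. For empty `L` the colouring is constant on every class;
  -- once `L` lists all vertices the condition is vacuous.
  ConstantOutside : ∀ {k} → List (Vertex T) → (Vertex total → Fin k) → Set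
  ConstantOutside L c′ = ∀ p q → πᵛ p ≡ πᵛ q → πᵛ p ∉ˡ L → c′ p ≡ c′ q

  RamseyOn : ℕ → List (Vertex T) → Set
  RamseyOn k L = ∀ (c′ : Vertex total → Fin k) → ConstantOutside L c′ → ∃ (Realises c′)

  Ramsey : ℕ → Set
  Ramsey k = ∀ (c′ : Vertex total → Fin k) → ∃ (Realises c′)

  total-injective : EdgesInjective T → EdgesInjective total
  total-injective inj f {i} {j} eq =
    inj (πᵉ f) (trans (sym (π-at f i)) (trans (cong πᵛ eq) (π-at f j)))

open Cover

identityCover : (T : Hypergraph R) → Cover T
identityCover T = record { total = T ; πᵛ = id ; πᵉ = id ; π-at = λ _ _ → refl }

identityCover-ramsey : (T : Hypergraph R) (k : ℕ) → Ramsey (identityCover T) k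
identityCover-ramsey T k c = c , (λ e → e , refl , λ _ → refl) , (λ v → v , refl , refl)

-- The isolated vertices inj₂ v make every class nonempty.
disjointCover : Finite R → (T : Hypergraph R) → Cover T
disjointCover {R} R-finite T = record
  { total = record
    { Vertex        = (Edge T × R) ⊎ Vertex T
    ; Edge          = Edge T
    ; at            = λ e i → inj₁ (e , i)
    ; vertex-finite = finite-⊎ (finite-× (edge-finite T) R-finite) (vertex-finite T)
    ; edge-finite   = edge-finite T
    }
  ; πᵛ   = λ { (inj₁ (e , i)) → at T e i ; (inj₂ v) → v }
  ; πᵉ   = id
  ; π-at = λ _ _ → refl
  }

disjointCover-girth : (fin : Finite R) (T : Hypergraph R) (g : ℕ) →
                      GirthAtLeast (total (disjointCover fin T)) g
disjointCover-girth fin T g _ w = closed w refl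
  where
  H = total (disjointCover fin T)

  same-edge : ∀ {x e f} → _∈ₑ_ H x e → _∈ₑ_ H x f → e ≡ f
  same-edge (_ , refl) (_ , refl) = refl

  starts : ∀ {x e f y n} → Walk H x e f y n → _∈ₑ_ H x e
  starts (single x∈ _ _)   = x∈
  starts (cons x∈ _ _ _ _) = x∈

  closed : ∀ {x e f y n} → Walk H x e f y n → x ≡ y → ⊥
  closed (single _ _ x≢y)     x≡y = x≢y x≡y
  closed (cons _ y∈ _ e≢f w) _   = e≢f (same-edge y∈ (starts w))

disjointCover-ramsey : (fin : Finite R) (T : Hypergraph R) (k : ℕ) →
                       RamseyOn (disjointCover fin T) k []
disjointCover-ramsey fin T k c′ const =
  (λ v → c′ (inj₂ v))
  , (λ e → e , refl , λ i → const (inj₁ (e , i)) (inj₂ (at T e i)) refl λ ())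
  , (λ v → inj₂ v , refl , refl)

-- Monochromatic edges without a girth condition.

-- Vertices are words in R of length k.  The edges of the k+1 case are those of the
-- |R| disjoint copies of the k case and all transversals of these copies: either
-- some copy avoids the first colour, or some transversal has only that colour.
module _ {r : ℕ} where

  words : ℕ → Hypergraph (Fin r)
  words zero = record
    { Vertex        = Fin 1
    ; Edge          = ⊥
    ; at            = λ ()
    ; vertex-finite = finite-Fin 1
    ; edge-finite   = 0 , ↔-sym 0↔⊥
    }
  words (suc k) = record
    { Vertex        = Fin r × Vertex W
    -- `Fin (n ^ r)` codes the functions from `Fin r` to `Fin n`, one vertex per copy, so that
    -- finiteness needs no function extensionality.
    ; Edge          = (Fin r × Edge W) ⊎ Fin (n ^ r)
    ; at            = λ { (inj₁ (i , e)) j → i , at W e j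
                        ; (inj₂ t) j → j , Inverse.from (proj₂ (vertex-finite W)) (finToFun t j) }
    ; vertex-finite = finite-× (finite-Fin r) (vertex-finite W)
    ; edge-finite   = finite-⊎ (finite-× (finite-Fin r) (edge-finite W)) (finite-Fin (n ^ r))
    }
    where
    W = words k
    n = proj₁ (vertex-finite W)

  words-injective : ∀ k → EdgesInjective (words k)
  words-injective (suc k) (inj₁ (i , e)) eq = words-injective k e (cong proj₂ eq)
  words-injective (suc k) (inj₂ t)       eq = cong proj₁ eq

  words-monochromatic : ∀ k → Monochromatic (words k) k
  words-monochromatic zero c with () ← c zero
  words-monochromatic (suc k) c
    with any? (λ i → ¬? (any-finite? (vertex-finite (words k)) λ w → c (i , w) Fin.≟ zero))
  ... | yes (i , none) =
    let avoids = λ w eq → none (w , sym eq)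
        (e , mono) = words-monochromatic k λ w → punchOut (avoids w)
    in inj₁ (i , e) , λ j l → punchOut-injective (avoids _) (avoids _) (mono j l)
  ... | no ¬none = inj₂ t , λ i j → trans (at-t i) (sym (at-t j))
    where
    W = words k
    open Inverse (proj₂ (vertex-finite W))

    witness : ∀ i → ∃ λ w → c (i , w) ≡ zero
    witness i = decidable-stable
      (any-finite? (vertex-finite W) λ w → c (i , w) Fin.≟ zero) (λ none → ¬none (i , none))

    t = funToFin λ i → to (proj₁ (witness i))

    at-t : ∀ i → c (i , from (finToFun t i)) ≡ zero
    at-t i = trans
      (cong (λ w → c (i , w))
        (trans (cong from (finToFun-funToFin _ i)) (strictlyInverseʳ (proj₁ (witness i)))))
      (proj₂ (witness i))

reindex : (A → B) → Hypergraph B → Hypergraph A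
reindex f H = record
  { Vertex        = Vertex H
  ; Edge          = Edge H
  ; at            = λ e → at H e ∘ f
  ; vertex-finite = vertex-finite H
  ; edge-finite   = edge-finite H
  }

monochromatic-exists : Finite R → (k : ℕ) →
  Σ[ H ∈ Hypergraph R ] EdgesInjective H × Monochromatic H k
monochromatic-exists (r , f) k =
  reindex to (words k)
  , (λ e eq → injective (words-injective k e eq))
  , λ c → let (e , mono) = words-monochromatic k c in e , λ i j → mono (to i) (to j)
  where open Injection (↔⇒↣ f) using (to; injective)

-- Amalgamation along one vertex class.

module Amalgamation {T : Hypergraph R} (T-injective : EdgesInjective T) (P : Cover T)
                    (v : Vertex T) (H : Hypergraph (Vertex (total P)))
                    (H-injective : EdgesInjective H) where

  private
    Q = total P

  -- Copies of Q, one for each edge of H, whose vertices of class v are identified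
  -- with vertices of that edge.  Indexing the edges of H by all of Vertex Q, rather
  -- than by the class v, leaves only some isolated vertices outside the images.
  glue : Edge H → Vertex Q → Vertex H ⊎ (Edge H × Vertex Q)
  glue e p with _≟ᵛ_ T (πᵛ P p) v
  ... | yes _ = inj₁ (at H e p)
  ... | no  _ = inj₂ (e , p)

  class : Vertex H ⊎ (Edge H × Vertex Q) → Vertex T
  class (inj₁ _)       = v
  class (inj₂ (_ , p)) = πᵛ P p

  class-glue : ∀ e p → class (glue e p) ≡ πᵛ P p
  class-glue e p with _≟ᵛ_ T (πᵛ P p) v
  ... | yes eq = sym eq
  ... | no  _  = refl

  glue-v : ∀ e {p} → πᵛ P p ≡ v → glue e p ≡ inj₁ (at H e p)
  glue-v e {p} eq with _≟ᵛ_ T (πᵛ P p) v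
  ... | yes _  = refl
  ... | no ¬eq = contradiction eq ¬eq

  glue-injective : ∀ e {p q} → glue e p ≡ glue e q → p ≡ q
  glue-injective e {p} {q} eq with _≟ᵛ_ T (πᵛ P p) v | _≟ᵛ_ T (πᵛ P q) v
  glue-injective e eq   | yes _ | yes _ = H-injective e (inj₁-injective eq)
  glue-injective e ()   | yes _ | no _
  glue-injective e ()   | no _  | yes _
  glue-injective e refl | no _  | no _  = refl

  glue-shared : ∀ {e e′ p q} → e ≢ e′ → glue e p ≡ glue e′ q →
                πᵛ P p ≡ v × πᵛ P q ≡ v × at H e p ≡ at H e′ q
  glue-shared {p = p} {q} e≢ eq with _≟ᵛ_ T (πᵛ P p) v | _≟ᵛ_ T (πᵛ P q) v
  glue-shared e≢ eq   | yes a | yes b = a , b , inj₁-injective eq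
  glue-shared e≢ ()   | yes _ | no _
  glue-shared e≢ ()   | no _  | yes _
  glue-shared e≢ refl | no _  | no _  = contradiction refl e≢

  amalgam : Cover T
  amalgam = record
    { total = record
      { Vertex        = Vertex H ⊎ (Edge H × Vertex Q)
      ; Edge          = Edge H × Edge Q
      ; at            = λ (e , f) i → glue e (at Q f i)
      ; vertex-finite = finite-⊎ (vertex-finite H) (finite-× (edge-finite H) (vertex-finite Q))
      ; edge-finite   = finite-× (edge-finite H) (edge-finite Q)
      }
    ; πᵛ   = class
    ; πᵉ   = λ (_ , f) → πᵉ P f
    ; π-at = λ (e , f) i → trans (class-glue e (at Q f i)) (π-at P f i)
    }

  -- On the copy at the monochromatic edge `e`, all vertices of class `v` get the same colour, so
  -- `c′ ∘ glue e` satisfies the constancy condition of `P` with `v` dropped from the list.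
  amalgam-ramsey : ∀ {k L} → Monochromatic H k → RamseyOn P k L → RamseyOn amalgam k (v ∷ L)
  amalgam-ramsey {k} {L} mono ramsey c′ const =
    let (c , edges , vertices) = ramsey (c′ ∘ glue e) const-glue in
    c
    , (λ a → let (f , over , col) = edges a in (e , f) , over , col)
    , (λ u → let (p , over , col) = vertices u in glue e p , trans (class-glue e p) over , col)
    where
    e = proj₁ (mono (c′ ∘ inj₁))

    const-glue : ConstantOutside P L (c′ ∘ glue e)
    const-glue p q eq p∉L with _≟ᵛ_ T (πᵛ P p) v
    ... | yes p≡v rewrite glue-v e {q} (trans (sym eq) p≡v) = proj₂ (mono (c′ ∘ inj₁)) p q
    ... | no  p≢v = const (inj₂ (e , p)) (glue e q) (trans eq (sym (class-glue e q)))
                      λ { (here p≡v) → p≢v p≡v ; (there p∈L) → p∉L p∈L }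

  private
    M = total amalgam

  -- The part of a walk in the amalgam strictly between the copies e and e′ in which
  -- it starts and ends, as a walk in H.
  data Bridge (e : Edge H) (x x′ : Vertex H) (e′ : Edge H) : ℕ → Set where
    direct : x ≡ x′ → e ≢ e′ → Bridge e x x′ e′ 0
    via    : ∀ {e₁ e₂ s} → e ≢ e₁ → Walk H x e₁ e₂ x′ s → e₂ ≢ e′ → Bridge e x x′ e′ s

  bridge-cons : ∀ {e e₁ e′ x x₁ x′ s} → e ≢ e₁ → _∈ₑ_ H x e₁ → _∈ₑ_ H x₁ e₁ → x ≢ x₁ →
                Bridge e₁ x₁ x′ e′ s → Bridge e x x′ e′ (suc s)
  bridge-cons e≢ x∈ x₁∈ x≢ (direct refl e₁≢) = via e≢ (single x∈ x₁∈ x≢) e₁≢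
  bridge-cons e≢ x∈ x₁∈ x≢ (via e₁≢ w e₂≢)   = via e≢ (cons x∈ x₁∈ x≢ e₁≢ w) e₂≢

  -- A walk that leaves its copy is cut into a first part, a bridge over the copies crossed, and a
  -- last part. The bound counts each bridge edge twice, as crossing a copy costs at least two
  -- edges.
  data Collapsed (e : Edge H) (f : Edge Q) (e′ : Edge H) (n : ℕ) (y y′ : Vertex M) : Set where
    within : ∀ {p p′ f′} → e ≡ e′ → y ≡ glue e p → Walk Q p f f′ p′ n → y′ ≡ glue e′ p′ →
             Collapsed e f e′ n y y′
    across : ∀ {p q q′ p′ f₁ f₂ f₃ a b s} →
             y ≡ glue e p → Walk Q p f f₁ q a → πᵛ P q ≡ v →
             Bridge e (at H e q) (at H e′ q′) e′ s →
             πᵛ P q′ ≡ v → Walk Q q′ f₂ f₃ p′ b → y′ ≡ glue e′ p′ →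
             a + (s + s) + b ≤ n →
             Collapsed e f e′ n y y′

  -- A single edge of Q meets the class v at most once.
  class-distance : ∀ {p q f f′ a} → πᵛ P p ≡ v → πᵛ P q ≡ v → Walk Q p f f′ q a → 2 ≤ a
  class-distance p≡v q≡v (single (i , refl) (j , refl) p≢q) = contradiction
    (cong (at Q _) (T-injective _ (trans (sym (π-at P _ i)) (trans p≡v (trans (sym q≡v) (π-at P _ j))))))
    p≢q
  class-distance _ _ (cons _ _ _ _ w) = s≤s (walk-nonempty Q w)

  module _ {g : ℕ} (Q-girth : GirthAtLeast Q (suc g)) where

    -- Distinct copies share only vertices of class v, and an excursion into a copy
    -- from this class back to it is not closed, hence takes at least two edges.
    collapse : ∀ {y e f e′ f′ y′ n} → n ≤ g → Walk M y (e , f) (e′ , f′) y′ n →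
               Collapsed e f e′ n y y′
    collapse {e = e} n≤g (single (i , refl) (j , refl) y≢) =
      within refl refl (single (i , refl) (j , refl) (y≢ ∘ cong (glue e))) refl
    collapse {e = e} {f} n≤g (cons {f = e₁ , f₁} (i , refl) (j , refl) y≢ ef≢ w)
      with _≟ᵉ_ H e e₁ | collapse (≤-trans (m≤n⇒m≤1+n ≤-refl) n≤g) w
    ... | yes refl | within refl eq w₁ eq′ with refl ← glue-injective e eq =
      within refl refl (cons (i , refl) (j , refl) (y≢ ∘ cong (glue e)) (ef≢ ∘ cong (e ,_)) w₁) eq′
    ... | yes refl | across eq w₁ q≡v br q′≡v w₂ eq′ len with refl ← glue-injective e eq =
      across refl (cons (i , refl) (j , refl) (y≢ ∘ cong (glue e)) (ef≢ ∘ cong (e ,_)) w₁)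
        q≡v br q′≡v w₂ eq′ (s≤s len)
    ... | no e≢ | within refl eq w₁ eq′ with (j≡v , p≡v , eq″) ← glue-shared e≢ eq =
      across refl (single (i , refl) (j , refl) (y≢ ∘ cong (glue e))) j≡v
        (direct eq″ e≢) p≡v w₁ eq′ ≤-refl
    -- The walk enters `e₁` and crosses it, so `w₁` turns into one more bridge step in `H`. The new
    -- first part has length 1, and `2 ≤ a` pays for counting that step twice.
    ... | no e≢ | across {p} {q} {a = a} {b} {s} eq w₁ q≡v br q′≡v w₂ eq′ len
      with (j≡v , p≡v , eq″) ← glue-shared e≢ eq =
      across refl (single (i , refl) (j , refl) (y≢ ∘ cong (glue e))) j≡v
        (bridge-cons e≢ (p , sym eq″) (q , refl) x≢x₁ br) q′≡v w₂ eq′ (s≤s len′)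
      where
      open ≤-Reasoning

      a<1+g : a < suc g
      a<1+g = s≤s (≤-trans (m≤m+n a (s + s)) (≤-trans (m≤m+n _ b)
                (≤-trans len (≤-trans (m≤n⇒m≤1+n ≤-refl) n≤g))))

      -- Otherwise `w₁` would be a closed walk in `Q` of length below `suc g`.
      x≢x₁ : at H e (at Q f j) ≢ at H e₁ q
      x≢x₁ eq₁ with refl ← H-injective e₁ (trans (sym eq″) eq₁) = Q-girth a<1+g w₁

      len′ : suc s + suc s + b ≤ _
      len′ = begin
        suc s + suc s + b ≡⟨ cong (λ t → suc t + b) (+-suc s s) ⟩
        2 + (s + s) + b   ≤⟨ +-monoˡ-≤ b (+-monoˡ-≤ (s + s) (class-distance p≡v q≡v w₁)) ⟩
        a + (s + s) + b   ≤⟨ len ⟩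
        _                 ∎

    -- A closed walk inside one copy contradicts the girth of `Q`. Otherwise `H` gets a closed walk
    -- shorter than `g`: if the end copies agree, `e` closes the bridge; if not, the base point lies
    -- in both, hence in class `v`, and the end parts become steps along `e` and `e′`.
    amalgam-girth : GirthAtLeast H g → GirthAtLeast M (suc g)
    amalgam-girth H-girth {x = y} {e , f} {e′ , f′} (s≤s n≤g) w with collapse n≤g w
    ... | within refl eq w₁ eq′ with refl ← glue-injective e (trans (sym eq) eq′) =
      Q-girth (s≤s n≤g) w₁
    ... | across {p} {q} {q′} {p′} {a = a} {b} {s} eq w₁ q≡v br q′≡v w₂ eq′ len
      with _≟ᵉ_ H e e′ | br
    ...   | yes refl | direct _ e≢ = e≢ refl
    ...   | yes refl | via e≢ wʰ _ = girth⇒no-edge-closed H H-girth (≤-trans s+2≤ (≤-trans len n≤g))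
                                       (q , refl) (q′ , refl) e≢ wʰ
      where
      s+2≤ : suc (suc s) ≤ a + (s + s) + b
      s+2≤ = begin
        2 + s           ≡⟨ +-comm 2 s ⟩
        s + 2           ≡⟨ +-suc s 1 ⟩
        1 + (s + 1)     ≡⟨⟩
        1 + s + 1       ≤⟨ +-mono-≤ (+-mono-≤ (walk-nonempty Q w₁) (m≤m+n s s)) (walk-nonempty Q w₂) ⟩
        a + (s + s) + b ∎
        where open ≤-Reasoning
    ...   | no e≢ | _ with (p≡v , p′≡v , eq″) ← glue-shared e≢ (trans (sym eq) eq′) = closes br
      where
      3+s≤g : 3 + s ≤ g
      3+s≤g = begin
        3 + s           ≡⟨ cong (2 +_) (+-comm 1 s) ⟩
        2 + s + 1       ≤⟨ +-mono-≤ (+-mono-≤ (class-distance p≡v q≡v w₁) (m≤m+n s s)) (walk-nonempty Q w₂) ⟩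
        a + (s + s) + b ≤⟨ len ⟩
        _               ≤⟨ n≤g ⟩
        g               ∎
        where open ≤-Reasoning

      a≤g : a ≤ g
      a≤g = ≤-trans (m≤m+n a (s + s)) (≤-trans (m≤m+n _ b) (≤-trans len n≤g))

      b≤g : b ≤ g
      b≤g = ≤-trans (m≤n+m b (a + (s + s))) (≤-trans len n≤g)

      x≢ : at H e p ≢ at H e q
      x≢ eq₁ with refl ← H-injective e eq₁ = Q-girth (s≤s a≤g) w₁

      x′≢ : at H e′ q′ ≢ at H e p
      x′≢ eq₁ with refl ← H-injective e′ (trans eq₁ eq″) = Q-girth (s≤s b≤g) w₂

      closes : Bridge e (at H e q) (at H e′ q′) e′ s → ⊥
      closes (direct eq₁ _) = H-girth 3+s≤g
        (snoc H (single (p , refl) (q , refl) x≢) e≢ (q′ , sym eq₁) (p′ , sym eq″) (x≢ ∘ sym))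
      closes (via e≢₁ wʰ e₂≢) = H-girth 3+s≤g
        (snoc H (cons (p , refl) (q , refl) x≢ e≢₁ wʰ) e₂≢ (q′ , refl) (p′ , sym eq″) x′≢)

-- The induction on girth.

-- Each turn of the mutual recursion lowers `g` by one. `R` must be arbitrary because the edges of
-- `H` are indexed by all vertices of the current cover.
sparseCover : ∀ (g : ℕ) → Finite R → (T : Hypergraph R) → EdgesInjective T → ∀ k →
              Σ[ P ∈ Cover T ] GirthAtLeast (total P) g × Ramsey P k
-- An edge of `T` monochromatic under the realised colouring has an edge above it with the same
-- colours.
sparseMonochromatic : ∀ (g : ℕ) → Finite R → ∀ k →
  Σ[ H ∈ Hypergraph R ] EdgesInjective H × GirthAtLeast H g × Monochromatic H k

sparseCover zero _ T _ k = identityCover T , (λ ()) , identityCover-ramsey T k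
sparseCover (suc g) R-finite T T-injective k =
  let (P , P-girth , ramsey) = amalgamate (elements (vertex-finite T))
  in P , P-girth , λ c′ → ramsey c′ λ p _ _ p∉ → contradiction (∈-elements (vertex-finite T) (πᵛ P p)) p∉
  where
  amalgamate : ∀ L → Σ[ P ∈ Cover T ] GirthAtLeast (total P) (suc g) × RamseyOn P k L
  amalgamate []      =
    disjointCover R-finite T
    , disjointCover-girth R-finite T (suc g)
    , disjointCover-ramsey R-finite T k
  amalgamate (v ∷ L) =
    let (P , P-girth , ramsey)             = amalgamate L
        (H , H-injective , H-girth , mono) = sparseMonochromatic g (vertex-finite (total P)) k
        open Amalgamation T-injective P v H H-injective
    in amalgam , amalgam-girth P-girth H-girth , amalgam-ramsey mono ramsey

sparseMonochromatic g R-finite k =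
  let (T , T-injective , mono)   = monochromatic-exists R-finite k
      (P , P-girth , ramsey) = sparseCover g R-finite T T-injective k
  in total P , total-injective P T-injective , P-girth , λ c′ →
     let (c , edges , _)   = ramsey c′
         (e , same)        = mono c
         (f , _ , realise) = edges e
     in f , λ i j → trans (realise i) (trans (same i j) (sym (realise j)))

-- Graphs as hypergraphs of arcs.

-- Every edge of G occurs in both orientations.
module _ (G : Graph) where

  private
    pairs = cartesianProduct (allFin (order G)) (allFin (order G))

    adjacent? : (p : V G × V G) → Dec (Adj G (proj₁ p) (proj₂ p))
    adjacent? (u , v) = adj? G u v

  arcs : List (V G × V G)
  arcs = filter adjacent? pairs

  arc-adj : ∀ a → Adj G (proj₁ (lookup arcs a)) (proj₂ (lookup arcs a))
  arc-adj a = proj₂ (∈-filter⁻ adjacent? {xs = pairs} (∈-lookup a))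

  arc-exists : ∀ {u v} → Adj G u v → ∃ λ a → lookup arcs a ≡ (u , v)
  arc-exists {u} {v} uv = index uv∈ , sym (lookup-index uv∈)
    where
    uv∈ : (u , v) ∈ˡ arcs
    uv∈ = ∈-filter⁺ adjacent? (∈-cartesianProduct⁺ (∈-allFin u) (∈-allFin v)) uv

  endpoint : V G × V G → Fin 2 → V G
  endpoint (u , v) zero       = u
  endpoint (u , v) (suc zero) = v

  arcHypergraph : Hypergraph (Fin 2)
  arcHypergraph = record
    { Vertex        = V G
    ; Edge          = Fin (length arcs)
    ; at            = endpoint ∘ lookup arcs
    ; vertex-finite = finite-Fin _
    ; edge-finite   = finite-Fin _
    }

  endpoints-adj : ∀ a {i j} → i ≢ j → Adj G (at arcHypergraph a i) (at arcHypergraph a j)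
  endpoints-adj a {zero}     {zero}     i≢j = contradiction refl i≢j
  endpoints-adj a {zero}     {suc zero} i≢j = arc-adj a
  endpoints-adj a {suc zero} {zero}     i≢j = symm G (arc-adj a)
  endpoints-adj a {suc zero} {suc zero} i≢j = contradiction refl i≢j

  arcHypergraph-injective : EdgesInjective arcHypergraph
  arcHypergraph-injective a {i} {j} eq with i Fin.≟ j
  ... | yes i≡j = i≡j
  ... | no  i≢j = contradiction (endpoints-adj a i≢j) (irrefl G eq)

-- The graph underlying a hypergraph, and its cycles.

module Shadow (H : Hypergraph (Fin 2)) (H-injective : EdgesInjective H) where

  open Inverse (proj₂ (vertex-finite H)) public using (to; from; strictlyInverseˡ; strictlyInverseʳ)

  Joined : Edge H → Vertex H → Vertex H → Set
  Joined e x y = ∃₂ λ i j → i ≢ j × at H e i ≡ x × at H e j ≡ y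

  shadow : Graph
  shadow = record
    { order  = proj₁ (vertex-finite H)
    ; Adj    = λ u v → ∃ λ e → Joined e (from u) (from v)
    ; adj?   = λ u v → any-finite? (edge-finite H) λ e → any? λ i → any? λ j →
                 ¬? (i Fin.≟ j) ×-dec (_≟ᵛ_ H (at H e i) (from u) ×-dec _≟ᵛ_ H (at H e j) (from v))
    ; symm   = λ (e , i , j , i≢j , p , q) → e , j , i , i≢j ∘ sym , q , p
    ; irrefl = λ { refl (e , i , j , i≢j , p , q) → i≢j (H-injective e (trans p (sym q))) }
    }

  from-injective : ∀ {u v} → from u ≡ from v → u ≡ v
  from-injective {u} {v} eq = trans (sym (strictlyInverseˡ u)) (trans (cong to eq) (strictlyInverseˡ v))

  two-of-three : (i j l : Fin 2) → i ≡ j ⊎ j ≡ l ⊎ i ≡ l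
  two-of-three zero       zero       _          = inj₁ refl
  two-of-three zero       (suc zero) zero       = inj₂ (inj₂ refl)
  two-of-three zero       (suc zero) (suc zero) = inj₂ (inj₁ refl)
  two-of-three (suc zero) (suc zero) _          = inj₁ refl
  two-of-three (suc zero) zero       zero       = inj₂ (inj₁ refl)
  two-of-three (suc zero) zero       (suc zero) = inj₂ (inj₂ refl)

  -- Used to show that consecutive hyperedges along a cycle differ: equal ones would contain three
  -- distinct vertices.
  no-three : ∀ {e x y z} → _∈ₑ_ H x e → _∈ₑ_ H y e → _∈ₑ_ H z e → x ≢ y → y ≢ z → x ≢ z → ⊥
  no-three (i , refl) (j , refl) (l , refl) x≢y y≢z x≢z with two-of-three i j l
  ... | inj₁ refl        = x≢y refl
  ... | inj₂ (inj₁ refl) = y≢z refl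
  ... | inj₂ (inj₂ refl) = x≢z refl

  module _ {ℓ : ℕ} {x : Fin ℓ → V shadow} (cycle : IsCycle shadow ℓ x) where
    open IsCycle cycle

    private
      y : Fin ℓ → Vertex H
      y = from ∘ x

      y-distinct : ∀ {i j : Fin ℓ} → toℕ i ≢ toℕ j → y i ≢ y j
      y-distinct i≢j eq = i≢j (cong toℕ (distinct (from-injective eq)))

      Next : Fin ℓ → Fin ℓ → Set
      Next i j = toℕ j ≡ suc (toℕ i) ⊎ (suc (toℕ i) ≡ ℓ × toℕ j ≡ 0)

      toℕ-suc : ∀ {i : Fin ℓ} {d} → toℕ i + suc (suc d) ≡ ℓ → suc (toℕ i) + suc d ≡ ℓ
      toℕ-suc {i} = trans (sym (+-suc (toℕ i) _))

      -- When the second step wraps around, returning to `i` would force ℓ = 2, which `long`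
      -- excludes.
      skip : ∀ {i j l : Fin ℓ} → toℕ j ≡ suc (toℕ i) → Next j l → toℕ i ≢ toℕ l
      skip {i} j≡ (inj₁ l≡) i≡l = m≢1+n+m (toℕ i) {1} (trans i≡l (trans l≡ (cong suc j≡)))
      skip {i} j≡ (inj₂ (end , l≡0)) i≡l = <-irrefl (sym ℓ≡2) long
        where
        ℓ≡2 : ℓ ≡ 2
        ℓ≡2 = trans (sym end) (cong suc (trans j≡ (cong suc (trans i≡l l≡0))))

    -- Vertex `i` is followed by `d` steps and the closing edge. The vertex `j` returned with the
    -- walk also lies on its first edge, which lets the preceding step rule out backtracking.
    walk-to-start : ∀ z → toℕ z ≡ 0 → ∀ d i → toℕ i + suc d ≡ ℓ →
      ∃₂ λ e f → Walk H (y i) e f (y z) (suc d) × ∃ λ j → Next i j × _∈ₑ_ H (y j) e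
    walk-to-start z z≡0 zero i i+1≡ =
      let end = trans (+-comm 1 (toℕ i)) i+1≡
          i≢z = λ eq → <⇒≢ (≤-trans (s≤s (s≤s z≤n)) long) (trans (cong suc (sym (trans eq z≡0))) end)
          (e , a , b , _ , p , q) = close i z end z≡0
      in e , e , single (a , p) (b , q) (y-distinct i≢z) , z , inj₂ (end , z≡0) , (b , q)
    walk-to-start z z≡0 (suc d) i i+d≡ =
      let e , a , b , _ , p , q = step i j j≡
          e₁ , f , w , l , next , l∈ = walk-to-start z z≡0 d j (trans (cong (_+ suc d) j≡) (toℕ-suc {i} i+d≡))
          j≢ = y-distinct λ eq → 1+n≢n (trans (sym j≡) (sym eq))
          e≢e₁ = λ eq → no-three (a , p) (b , q) (subst (_∈ₑ_ H (y l)) (sym eq) l∈)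
                   j≢ (next-distinct next) (y-distinct (skip {i} {j} j≡ next))
      in e , f , cons (a , p) (b , q) j≢ e≢e₁ w , j , inj₁ j≡ , (b , q)
      where
      1+i<ℓ : suc (toℕ i) < ℓ
      1+i<ℓ = ≤-trans (s≤s (m≤m+n _ d)) (≤-reflexive (trans (sym (+-suc _ d)) (toℕ-suc {i} i+d≡)))

      j = fromℕ< 1+i<ℓ
      j≡ = toℕ-fromℕ< 1+i<ℓ

      next-distinct : ∀ {l} → Next j l → y j ≢ y l
      next-distinct (inj₁ l≡) = y-distinct λ eq → 1+n≢n (trans (sym l≡) (sym eq))
      next-distinct (inj₂ (_ , l≡0)) = y-distinct λ eq → 1+n≢0 (trans (sym j≡) (trans eq l≡0))

  shadow-girth : ∀ {g ℓ} → GirthAtLeast H g → HasCycle shadow ℓ → g ≤ ℓ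
  shadow-girth {ℓ = suc d} H-girth (x , cycle) = ≮⇒≥ λ ℓ<g →
    let (_ , _ , w , _) = walk-to-start cycle zero refl d zero refl in H-girth ℓ<g w
  shadow-girth {ℓ = zero} H-girth (x , cycle) with () ← IsCycle.long cycle

-- Lifting colourings and the chromatic number.

cycles-long⇒girth : ∀ {G g} → (∀ {ℓ} → HasCycle G ℓ → g ≤ ℓ) → [ g ] ≤⁺ girth G
cycles-long⇒girth {G} {g} long with girth G | girth-isGirth G
... | [ ℓ ] | (cycle , _) = _≤⁺_.[_] (long cycle)
... | ⊤⁺    | _           = _≤⁺_._≤⊤⁺ [ g ]

Lifts : (G′ G : Graph) → (V G′ → V G) → ℕ → Set
Lifts G′ G h k = (c′ : V G′ → Fin k) → IsProperColouring G′ k c′ →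
  Σ[ c ∈ (V G → Fin k) ] IsProperColouring G k c × ((v : V G) → c v ∈ Image c′ (h ⊢ ｛ v ｝))

-- Each colour that the lift picks at `v` occurs above `v` in the embedded colouring, so reading
-- `c′` off at that witness recovers it among the `j` colours.
lifts-≤ : ∀ {G′ G h j k} → j ≤ k → Lifts G′ G h k → Lifts G′ G h j
lifts-≤ {G = G} {j = j} {k} j≤k lifts c′ proper =
  let (c , c-proper , picks) = lifts (λ x → inject≤ (c′ x) j≤k)
                                 (λ uv eq → proper uv (inject≤-injective _ _ _ _ eq))
      c₁ = λ v → c′ (proj₁ (picks v))
      c₁≡c = λ v → proj₂ (proj₂ (picks v))
  in c₁
   , (λ {u} {v} uv eq →
       c-proper uv (trans (sym (c₁≡c u)) (trans (cong (λ i → inject≤ i j≤k) eq) (c₁≡c v))))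
   , λ v → proj₁ (picks v) , proj₁ (proj₂ (picks v)) , refl

-- Colourings of `G` pull back along `h`. Conversely, an optimal colouring of `G′` has at most χ(G)
-- ≤ k colours, so it descends to `G`.
lifts⇒χ≡ : ∀ {G′ G h k} → IsHomomorphism G′ G h → χ G ≤ k → Lifts G′ G h k → χ G′ ≡ χ G
lifts⇒χ≡ {G′} {G} {h} hom χ≤k lifts = ≤-antisym χ′≤χ χ≤χ′
  where
  χ′≤χ : χ G′ ≤ χ G
  χ′≤χ = let ((c , proper) , _) = χ-isLeast G in
    proj₂ (χ-isLeast G′) (χ G) ((c ∘ h) , λ uv → proper (hom uv))

  χ≤χ′ : χ G ≤ χ G′
  χ≤χ′ =
    let ((c′ , proper) , _) = χ-isLeast G′
        (c , c-proper , _)  = lifts-≤ {G′} {G} {h} (≤-trans χ′≤χ χ≤k) lifts c′ proper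
    in proj₂ (χ-isLeast G) (χ G′) (c , c-proper)

sparse-lift : (G : Graph) (g k : ℕ) → 1 ≤ k →
  Σ[ G′ ∈ Graph ] Σ[ h ∈ (V G′ → V G) ]
    ([ g ] ≤⁺ girth G′) × IsHomomorphism G′ G h × Surjective _≡_ _≡_ h × Lifts G′ G h k
sparse-lift G g k 1≤k = shadow , h , cycles-long⇒girth (shadow-girth P-girth) , hom , onto , lifts
  where
  T = arcHypergraph G
  T-injective = arcHypergraph-injective G

  sparse = sparseCover g (finite-Fin 2) T T-injective k
  P = proj₁ sparse
  P-girth = proj₁ (proj₂ sparse)
  ramsey = proj₂ (proj₂ sparse)

  open Shadow (total P) (total-injective P T-injective)

  h : V shadow → V G
  h = πᵛ P ∘ from

  hom : IsHomomorphism shadow G h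
  hom (f , i , j , i≢j , p , q) =
    subst₂ (Adj G) (over i p) (over j q) (endpoints-adj G (πᵉ P f) i≢j)
    where
    over : ∀ i {x} → at (total P) f i ≡ x → at T (πᵉ P f) i ≡ πᵛ P x
    over i eq = trans (sym (π-at P f i)) (cong (πᵛ P) eq)

  onto : Surjective _≡_ _≡_ h
  onto v =
    -- Fibres are nonempty as soon as some colouring exists; `1≤k` provides a constant one.
    let (_ , _ , vertices) = ramsey λ _ → fromℕ< 1≤k
        (p , over , _)     = vertices v
    in to p , λ { refl → trans (cong (πᵛ P) (strictlyInverseʳ p)) over }

  lifts : Lifts shadow G h k
  lifts c′ proper = c , c-proper , picks
    where
    realised = ramsey (c′ ∘ to)
    c = proj₁ realised

    c-proper : IsProperColouring G k c
    c-proper uv eq =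
      let (a , a≡)       = arc-exists G uv
          (f , _ , same) = proj₁ (proj₂ realised) a
          ends = λ i → trans (same i) (cong (λ e → c (endpoint G e i)) a≡)
      -- The ends of `f` carry the colours of `u` and `v` and are adjacent in `shadow`.
      in proper (f , zero , suc zero , (λ ()) , sym (strictlyInverseʳ _) , sym (strictlyInverseʳ _))
           (trans (ends zero) (trans eq (sym (ends (suc zero)))))

    picks : ∀ v → c v ∈ Image c′ (h ⊢ ｛ v ｝)
    picks v =
      let (p , over , same) = proj₂ (proj₂ realised) v
      in to p , sym (trans (cong (πᵛ P) (strictlyInverseʳ p)) over) , same

mainTheorem7 : (G : Graph) (g k : ℕ) → 1 ≤ g → 1 ≤ k →
    Σ[ G′ ∈ Graph ] Σ[ h ∈ (V G′ → V G) ]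
    ([ g ] ≤⁺ girth G′)
    × IsHomomorphism G′ G h
    × Surjective _≡_ _≡_ h
    × ((c′ : V G′ → Fin k) → IsProperColouring G′ k c′ →
    Σ[ c ∈ (V G → Fin k) ]
    IsProperColouring G k c
    × ((v : V G) → c v ∈ Image c′ (h ⊢ ｛ v ｝)))
    × χ G′ ≡ χ G
mainTheorem7 G g k _ 1≤k =
  -- Having at least χ(G) colours gives the equality of chromatic numbers; `lifts-≤` then returns to
  -- `k` colours.
  let (G′ , h , long , hom , onto , lifts) = sparse-lift G g (k ⊔ χ G) (≤-trans 1≤k (m≤m⊔n k (χ G)))
  in G′ , h , long , hom , onto
   , lifts-≤ {G′} {G} {h} (m≤m⊔n k (χ G)) lifts
   , lifts⇒χ≡ {G′} {G} {h} hom (m≤n⊔m k (χ G)) lifts
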